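{- There exists an infinite family of twin-free graphs $G$ such that $\overset{\rightarrow}{\Gamma}_{LD}(G)/\gamma_{LD}(G)\to 1/2$ as the number of vertices $n$ of $G$ tends to infinity.
   Context: For an undirected graph $G=(V,E)$, $S\subseteq V$ is a locating-dominating set if every $u\notin S$ has $N(u)\cap S\neq\emptyset$ and distinct $u,v\notin S$ satisfy $N(u)\cap S\neq N(v)\cap S$; $\gamma_{LD}(G)$ is the minimum size. For an orientation $D$ of $G$ (each edge given exactly one direction), $S$ is locating-dominating in $D$ if the same holds with $N(\cdot)$ replaced by the in-neighbourhood $N^-_D(\cdot)$; $\gamma_{LD}(D)$ is the minimum size. $\overset{\rightarrow}{\Gamma}_{LD}(G)=\max_D\gamma_{LD}(D)$ over all orientations $D$ of $G$. Distinct vertices $u,v$ are twins if $N(u)=N(v)$ or $N[u]=N[v]$; a graph is twin-free if it has no twins. -}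

module Defs where

open import Data.Nat using (ℕ; suc; _≤_; _<_; _*_; ∣_-_∣)
open import Data.Bool using (Bool; true; false; _∨_)
open import Data.Fin using (Fin; _≟_)
open import Data.Fin.Subset using (Subset; _∈_; _∉_; ∣_∣)
open import Data.Product using (Σ; ∃; _×_; _,_)
open import Data.Sum using (_⊎_)
open import Relation.Nullary using (¬_; does)
open import Relation.Binary.PropositionalEquality using (_≡_; _≢_)

record Graph (n : ℕ) : Set where
  field
    Adj   : Fin n → Fin n → Bool
    sym   : ∀ u v → Adj u v ≡ Adj v u
    irrefl : ∀ u → Adj u u ≡ false
open Graph public

record Orientation {n : ℕ} (G : Graph n) : Set where
  field
    Arc      : Fin n → Fin n → Bool
    arc⇒edge : ∀ u v → Arc u v ≡ true → Adj G u v ≡ true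
    edge⇒arc : ∀ u v → Adj G u v ≡ true → Arc u v ≡ true ⊎ Arc v u ≡ true
    antisym  : ∀ u v → ¬ (Arc u v ≡ true × Arc v u ≡ true)
open Orientation public

-- Locating-dominating set w.r.t. a "neighbourhood relation" R, where
-- R w u = true means w ∈ N(u) (for a digraph: w ∈ N⁻(u), i.e. arc w → u).
IsLD : {n : ℕ} → (Fin n → Fin n → Bool) → Subset n → Set
IsLD {n} R S =
  (∀ (u : Fin n) → u ∉ S → ∃ λ w → w ∈ S × R w u ≡ true)
  × (∀ (u v : Fin n) → u ∉ S → v ∉ S → u ≢ v →
       ¬ (∀ (w : Fin n) → w ∈ S → R w u ≡ R w v))

IsγLD : {n : ℕ} → (Fin n → Fin n → Bool) → ℕ → Set
IsγLD {n} R k =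
  (∃ λ (S : Subset n) → IsLD R S × ∣ S ∣ ≡ k)
  × (∀ (T : Subset n) → IsLD R T → k ≤ ∣ T ∣)

γLD≡ : {n : ℕ} → Graph n → ℕ → Set
γLD≡ G k = IsγLD (Adj G) k

ΓLD≡ : {n : ℕ} → Graph n → ℕ → Set
ΓLD≡ G k =
  (∃ λ (D : Orientation G) → IsγLD (Arc D) k)
  × (∀ (D : Orientation G) (j : ℕ) → IsγLD (Arc D) j → j ≤ k)

CAdj : {n : ℕ} → Graph n → Fin n → Fin n → Bool
CAdj G w u = does (w ≟ u) ∨ Adj G w u

TwinFree : {n : ℕ} → Graph n → Set
TwinFree {n} G = ∀ (u v : Fin n) → u ≢ v →
  ¬ (∀ w → Adj G w u ≡ Adj G w v) × ¬ (∀ w → CAdj G w u ≡ CAdj G w v)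

-- The sequence a k / b k tends to 1/2:
-- for every ε = 1/(m+1) there is K with |a k / b k − 1/2| < ε for all k ≥ K,
-- written cross-multiplied as (m+1)·|2·a k − b k| < 2·b k.
TendsToHalf : (ℕ → ℕ) → (ℕ → ℕ) → Set
TendsToHalf a b = ∀ (m : ℕ) → ∃ λ (K : ℕ) → ∀ (k : ℕ) → K ≤ k →
  suc m * ∣ 2 * a k - b k ∣ < 2 * b k

{-# OPTIONS --safe #-}
module Submission where

-- The vertices are the triples ((x , y) , k) with (x , y) in an ℓ × ℓ grid of cells and k one of five kinds
-- 𝕡, 𝕢, 𝕣, 𝕓, 𝕔. A cell spans the triangle 𝕡𝕢𝕣 with pendant vertices 𝕓 at 𝕡 and 𝕔 at 𝕢, and vertices of different
-- cells are adjacent when the cells share a row or column and the kinds lie in the same layer ({𝕡,𝕢,𝕣}, {𝕓} or {𝕔}).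
-- Triangle vertices of one cell are separated only inside that cell. In the graph this forces two chosen vertices in
-- every cell, and all the 𝕡 and 𝕢 suffice: γ_LD = 2 ℓ². In an orientation one vertex per triangle suffices for
-- this, since a tournament on three vertices has a vertex with one in- and one out-neighbour in it. Everything else
-- is located at cost O(ℓ log ℓ): each line of each kind is a tournament, hence has a dominating set of logarithmic
-- size, and a second one disjoint from it. An unchosen vertex thus has two chosen in-neighbours in its row and one in
-- its column, and no vertex outside its own cell and layer is adjacent to all three. So the maximum over orientations is at most
-- ℓ² + O(ℓ log ℓ), and it is at least ℓ² because 𝕢 and 𝕣 are almost twins when edges are oriented lexicographically.

open import Defs hiding (sym)
open import Data.Bool using (Bool; true; false; not; _∧_; _∨_; if_then_else_)
import Data.Bool.Properties as Bool
open import Data.Fin using (Fin; zero; suc; combine; remQuot)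
import Data.Fin as Fin
open import Data.Fin.Patterns using (0F; 1F; 2F)
import Data.Fin.Properties as Fin
open import Data.Fin.Subset
  using (Subset; inside; outside; _∈_; _∉_; ∣_∣; ⁅_⁆; _∪_; ⊤; ⊥) renaming (_-_ to _∖_)
open import Data.Fin.Subset.Properties
  using (_∈?_; anySubset?; ∈⊤; ∣p∣≤n; ∣⊥∣≡0; ∣⁅x⁆∣≡1; x∈⁅x⁆; x∈p∪q⁺;
          x∈p∧x≢y⇒x∈p-y; x∈p⇒∣p-x∣<∣p∣)
open import Data.List using (List; []; _∷_; _++_; length; map; filter; foldr; concatMap; allFin)
import Data.List.Properties as List
open import Data.List.Membership.Propositional using (lose) renaming (_∈_ to _∈ₗ_; _∉_ to _∉ₗ_)
import Data.List.Membership.DecPropositional as DecMembership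
import Data.List.Membership.Propositional.Properties as ∈ₗ
open import Data.List.Relation.Unary.Any using (here; there)
open import Data.Nat
open import Data.Nat.ListAction using (sum)
open import Data.Nat.Properties
open import Data.Nat.Solver using (module +-*-Solver)
open import Data.Product using (Σ; ∃; ∃₂; _×_; _,_; proj₁; proj₂)
import Data.Sum as Sum
open import Data.Sum using (_⊎_; inj₁; inj₂; [_,_]′)
open import Data.Vec using (lookup; []; _∷_; tabulate)
open import Data.Vec.Properties using (lookup∘tabulate)
open import Function using (_∘_; case_of_; Injective)
open import Relation.Nullary using (¬_; Dec; yes; no; does; contradiction; ¬?; _×-dec_; _⊎-dec_; _→-dec_)
open import Relation.Nullary.Decidable using (from-yes; dec-true; dec-false; map′)
open import Relation.Binary.Definitions using (tri<; tri≈; tri>)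
open import Relation.Unary using (Decidable)
open import Relation.Binary.PropositionalEquality

-- Extremal values by finite search; existence of the two parameters

does⇒ : ∀ {A : Set} (a? : Dec A) → does a? ≡ true → A
does⇒ (yes a) _ = a

-- The upper bound `b` is lowered by one as long as `P b` fails; the given witness excludes a
-- failure at zero.
maximum : {P : ℕ → Set} → Decidable P → ∀ b → (∀ k → P k → k ≤ b) → ∀ {a} → P a →
          ∃ λ k → P k × (∀ j → P j → j ≤ k)
maximum P? b bnd pa with P? b
... | yes pb = b , pb , bnd
maximum P? zero bnd {a} pa | no ¬p0 with refl ← n≤0⇒n≡0 (bnd a pa) = contradiction pa ¬p0
maximum P? (suc b) bnd pa | no ¬pb = maximum P? b
  (λ k pk → s≤s⁻¹ (≤∧≢⇒< (bnd k pk) λ { refl → ¬pb pk })) pa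

-- Here `l` is the current lower bound and `d` its distance to a known witness. Each failure at `l`
-- raises `l` and consumes one unit of `d`.
minimum-from : {P : ℕ → Set} → Decidable P → ∀ d l → (∀ k → P k → l ≤ k) → P (d + l) →
               ∃ λ k → P k × (∀ j → P j → k ≤ j)
minimum-from P? d l bnd pd with P? l
... | yes pl = l , pl , bnd
minimum-from P? zero l bnd pl | no ¬pl = contradiction pl ¬pl
minimum-from {P} P? (suc d) l bnd pd | no ¬pl = minimum-from P? d (suc l)
  (λ k pk → ≤∧≢⇒< (bnd k pk) λ { refl → ¬pl pk }) (subst P (sym (+-suc d l)) pd)

minimum : {P : ℕ → Set} → Decidable P → ∀ {a} → P a → ∃ λ k → P k × (∀ j → P j → k ≤ j)
minimum {P} P? {a} pa = minimum-from P? a 0 (λ _ _ → z≤n) (subst P (sym (+-identityʳ a)) pa)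

Rel₂ : ℕ → Set
Rel₂ n = Fin n → Fin n → Bool

isLD? : ∀ {n} (R : Rel₂ n) (S : Subset n) → Dec (IsLD R S)
isLD? R S =
  Fin.all? (λ u → ¬? (u ∈? S) →-dec Fin.any? (λ w → (w ∈? S) ×-dec (R w u Bool.≟ true)))
  ×-dec
  Fin.all? (λ u → Fin.all? (λ v → ¬? (u ∈? S) →-dec (¬? (v ∈? S) →-dec (¬? (u Fin.≟ v) →-dec
    ¬? (Fin.all? (λ w → (w ∈? S) →-dec (R w u Bool.≟ R w v)))))))

isLD-resp : ∀ {n} {R R′ : Rel₂ n} {S} → (∀ w u → R w u ≡ R′ w u) → IsLD R S → IsLD R′ S
isLD-resp eq (dom , loc) =
  (λ u u∉ → let (w , w∈ , Rwu) = dom u u∉ in w , w∈ , trans (sym (eq w u)) Rwu) ,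
  (λ u v u∉ v∉ u≢v same → loc u v u∉ v∉ u≢v λ w w∈ →
    trans (eq w u) (trans (same w w∈) (sym (eq w v))))

isγLD-resp : ∀ {n} {R R′ : Rel₂ n} {k} → (∀ w u → R w u ≡ R′ w u) → IsγLD R k → IsγLD R′ k
isγLD-resp eq ((S , ld , ∣S∣≡k) , min) =
  (S , isLD-resp eq ld , ∣S∣≡k) , λ T ld′ → min T (isLD-resp (λ w u → sym (eq w u)) ld′)

-- The locating clause only refutes agreement on all of `S`. Since equality of Booleans is
-- decidable, a search over the finitely many vertices turns this into an explicit witness.
isLD⇒separator : ∀ {n} {R : Rel₂ n} {S} → IsLD R S → ∀ {u v} → u ∉ S → v ∉ S → u ≢ v →
                 ∃ λ w → w ∈ S × R w u ≢ R w v
isLD⇒separator {n} {R} {S} (_ , loc) {u} {v} u∉ v∉ u≢v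
  with Fin.any? (λ w → (w ∈? S) ×-dec ¬? (R w u Bool.≟ R w v))
... | yes sep = sep
... | no ¬sep = contradiction same (loc u v u∉ v∉ u≢v)
  where
  same : ∀ w → w ∈ S → R w u ≡ R w v
  same w w∈ with R w u Bool.≟ R w v
  ... | yes eq = eq
  ... | no neq = contradiction (w , w∈ , neq) ¬sep

isγLD? : ∀ {n} (R : Rel₂ n) k → Dec (IsγLD R k)
isγLD? R k = anySubset? (λ S → isLD? R S ×-dec (∣ S ∣ ≟ k)) ×-dec lower
  where
  lower : Dec (∀ T → IsLD R T → k ≤ ∣ T ∣)
  -- The minimality clause is decided through its negation, which is an existential search for a
  -- smaller locating-dominating set.
  lower with anySubset? (λ T → isLD? R T ×-dec (∣ T ∣ <? k))
  ... | yes (T , ld , T<k) = no λ min → <⇒≱ T<k (min T ld)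
  ... | no none = yes λ T ld → ≮⇒≥ λ T<k → none (T , ld , T<k)

∃γLD : ∀ {n} (R : Rel₂ n) → ∃ (IsγLD R)
∃γLD {n} R =
  let (k , has , min) = minimum (λ k → anySubset? (λ S → isLD? R S ×-dec (∣ S ∣ ≟ k)))
                          (⊤ , ((λ _ u∉ → contradiction ∈⊤ u∉) , (λ _ _ u∉ → contradiction ∈⊤ u∉)) , refl)
  in k , has , λ T ld → min ∣ T ∣ (T , ld , refl)

-- The arcs of an orientation are encoded as a subset of Fin (n * n), so that a search over subsets
-- is a search over orientations.
module _ {n} (G : Graph n) where

  private
    arcs : Subset (n * n) → Rel₂ n
    arcs s u v = lookup s (combine u v)

    code : Rel₂ n → Subset (n * n)
    code R = tabulate λ i → R (proj₁ (remQuot n i)) (proj₂ (remQuot {n} n i))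

    arcs-code : ∀ R u v → arcs (code R) u v ≡ R u v
    arcs-code R u v = trans (lookup∘tabulate _ (combine u v))
      (cong (λ p → R (proj₁ p) (proj₂ p)) (Fin.remQuot-combine {n} u v))

    Oriented : Rel₂ n → Set
    Oriented R = (∀ u v → R u v ≡ true → Adj G u v ≡ true)
               × (∀ u v → Adj G u v ≡ true → R u v ≡ true ⊎ R v u ≡ true)
               × (∀ u v → ¬ (R u v ≡ true × R v u ≡ true))

    oriented? : Decidable Oriented
    oriented? R =
      Fin.all? (λ u → Fin.all? λ v → (R u v Bool.≟ true) →-dec (Adj G u v Bool.≟ true))
      ×-dec Fin.all? (λ u → Fin.all? λ v → (Adj G u v Bool.≟ true) →-dec
        ((R u v Bool.≟ true) ⊎-dec (R v u Bool.≟ true)))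
      ×-dec Fin.all? (λ u → Fin.all? λ v → ¬? ((R u v Bool.≟ true) ×-dec (R v u Bool.≟ true)))

    oriented-resp : ∀ {R R′} → (∀ u v → R u v ≡ R′ u v) → Oriented R → Oriented R′
    oriented-resp eq (f , g , h) =
      (λ u v r → f u v (trans (eq u v) r)) ,
      (λ u v a → [ inj₁ ∘ trans (sym (eq u v)) , inj₂ ∘ trans (sym (eq v u)) ]′ (g u v a)) ,
      (λ u v (r , r′) → h u v (trans (eq u v) r , trans (eq v u) r′))

  orientationWithγ? : Decidable (λ k → ∃ λ (D : Orientation G) → IsγLD (Arc D) k)
  orientationWithγ? k = map′ decode encode
    (anySubset? λ s → oriented? (arcs s) ×-dec isγLD? (arcs s) k)
    where
    decode : (∃ λ s → Oriented (arcs s) × IsγLD (arcs s) k) → ∃ λ (D : Orientation G) → IsγLD (Arc D) k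
    decode (s , (f , g , h) , γ) =
      record { Arc = arcs s ; arc⇒edge = f ; edge⇒arc = g ; antisym = h } , γ
    encode : (∃ λ (D : Orientation G) → IsγLD (Arc D) k) → ∃ λ s → Oriented (arcs s) × IsγLD (arcs s) k
    encode (D , γ) = code (Arc D) ,
      oriented-resp same (arc⇒edge D , edge⇒arc D , antisym D) , isγLD-resp same γ
      where
      same : ∀ u v → Arc D u v ≡ arcs (code (Arc D)) u v
      same u v = sym (arcs-code (Arc D) u v)

  -- The values attained by orientations are bounded by `n`, and `D₀` ensures that there is at least
  -- one of them.
  ∃ΓLD : Orientation G → ∃ (ΓLD≡ G)
  ∃ΓLD D₀ =
    let (k , has , max) = maximum orientationWithγ? n
          (λ { _ (_ , (S , _ , refl) , _) → ∣p∣≤n S }) (D₀ , proj₂ (∃γLD (Arc D₀)))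
    in k , has , λ D j γ → max j (D , γ)

-- Cardinalities of subsets and lengths of lists

injection⇒≤∣∣ : ∀ {a n} (T : Subset n) (f : Fin a → Fin n) → Injective _≡_ _≡_ f →
                (∀ i → f i ∈ T) → a ≤ ∣ T ∣
injection⇒≤∣∣ {zero} T f inj f∈ = z≤n
injection⇒≤∣∣ {suc a} T f inj f∈ = ≤-trans
  (s≤s (injection⇒≤∣∣ (T ∖ f zero) (f ∘ suc) (Fin.suc-injective ∘ inj)
    λ i → x∈p∧x≢y⇒x∈p-y (f∈ (suc i)) (λ eq → Fin.0≢1+n (sym (inj eq)))))
  (x∈p⇒∣p-x∣<∣p∣ (f∈ zero))

∣p∪q∣≤∣p∣+∣q∣ : ∀ {n} (p q : Subset n) → ∣ p ∪ q ∣ ≤ ∣ p ∣ + ∣ q ∣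
∣p∪q∣≤∣p∣+∣q∣ [] [] = z≤n
∣p∪q∣≤∣p∣+∣q∣ (outside ∷ p) (outside ∷ q) = ∣p∪q∣≤∣p∣+∣q∣ p q
∣p∪q∣≤∣p∣+∣q∣ (outside ∷ p) (inside ∷ q) =
  ≤-trans (s≤s (∣p∪q∣≤∣p∣+∣q∣ p q)) (≤-reflexive (sym (+-suc ∣ p ∣ ∣ q ∣)))
∣p∪q∣≤∣p∣+∣q∣ (inside ∷ p) (outside ∷ q) = s≤s (∣p∪q∣≤∣p∣+∣q∣ p q)
∣p∪q∣≤∣p∣+∣q∣ (inside ∷ p) (inside ∷ q) =
  s≤s (≤-trans (∣p∪q∣≤∣p∣+∣q∣ p q) (+-monoʳ-≤ ∣ p ∣ (n≤1+n ∣ q ∣)))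

fromList : ∀ {n} → List (Fin n) → Subset n
fromList = foldr (λ x S → ⁅ x ⁆ ∪ S) ⊥

∣fromList∣≤length : ∀ {n} (xs : List (Fin n)) → ∣ fromList xs ∣ ≤ length xs
∣fromList∣≤length {n} [] = ≤-reflexive (∣⊥∣≡0 n)
∣fromList∣≤length (x ∷ xs) = ≤-trans (∣p∪q∣≤∣p∣+∣q∣ ⁅ x ⁆ (fromList xs))
  (+-mono-≤ (≤-reflexive (∣⁅x⁆∣≡1 x)) (∣fromList∣≤length xs))

∈-fromList : ∀ {n} {x : Fin n} {xs} → x ∈ₗ xs → x ∈ fromList xs
∈-fromList {x = x} (here refl) = x∈p∪q⁺ (inj₁ (x∈⁅x⁆ x))
∈-fromList (there x∈) = x∈p∪q⁺ (inj₂ (∈-fromList x∈))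

length-concatMap-≤ : ∀ {A B : Set} (f : A → List B) {c} → (∀ x → length (f x) ≤ c) →
                     ∀ xs → length (concatMap f xs) ≤ length xs * c
length-concatMap-≤ f bnd [] = z≤n
length-concatMap-≤ f bnd (x ∷ xs) = ≤-trans (≤-reflexive (List.length-++ (f x)))
  (+-mono-≤ (bnd x) (length-concatMap-≤ f bnd xs))

-- Domination in tournaments

module _ {A : Set} (cov : A → A → Bool) where

  hit : A → A → ℕ
  hit w u = if cov w u then 1 else 0

  outDeg : A → List A → ℕ
  outDeg w = sum ∘ map (hit w)

  inDeg : List A → A → ℕ
  inDeg ws u = sum (map (λ w → hit w u) ws)

  hits : List A → List A → ℕ
  hits ws us = sum (map (λ w → outDeg w us) ws)

  unhit : A → List A → List A
  unhit w = filter (λ u → cov w u Bool.≟ false)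

  out+unhit : ∀ w us → outDeg w us + length (unhit w us) ≡ length us
  out+unhit w [] = refl
  out+unhit w (u ∷ us) with cov w u
  ... | true = cong suc (out+unhit w us)
  ... | false = trans (+-suc _ _) (cong suc (out+unhit w us))

  hits-∷ : ∀ ws u us → hits ws (u ∷ us) ≡ inDeg ws u + hits ws us
  hits-∷ [] u us = refl
  hits-∷ (w ∷ ws) u us rewrite hits-∷ ws u us =
    solve 4 (λ a b c d → (a :+ b) :+ (c :+ d) := (a :+ c) :+ (b :+ d)) refl
      (hit w u) (outDeg w us) (inDeg ws u) (hits ws us)
    where open +-*-Solver

  module _ (total : ∀ u v → cov u v ≡ true ⊎ cov v u ≡ true) where

    length≤out+in : ∀ w us → length us ≤ outDeg w us + inDeg us w
    length≤out+in w [] = z≤n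
    length≤out+in w (u ∷ us) = ≤-trans (+-mono-≤ one (length≤out+in w us))
      (≤-reflexive (solve 4 (λ a b c d → (a :+ b) :+ (c :+ d) := (a :+ c) :+ (b :+ d)) refl
        (hit w u) (hit u w) (outDeg w us) (inDeg us w)))
      where
      open +-*-Solver
      one : 1 ≤ hit w u + hit u w
      one with total w u
      ... | inj₁ eq rewrite eq = s≤s z≤n
      ... | inj₂ eq rewrite eq = m≤n+m 1 (hit w u)

    -- Totality is also assumed for equal arguments, so every vertex covers itself.
    hit-self : ∀ w → hit w w ≡ 1
    hit-self w with total w w
    ... | inj₁ eq rewrite eq = refl
    ... | inj₂ eq rewrite eq = refl

    -- A new head covers itself once, and with each later entry it forms a pair covered in at least
    -- one direction. A list of length n thus has at least n (n + 1) / 2 covered pairs.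
    many-hits : ∀ us → length us * length us + length us ≤ 2 * hits us us
    many-hits [] = z≤n
    many-hits (u ∷ us) = begin
      suc n * suc n + suc n
        ≡⟨ solve 1 (λ n → (con 1 :+ n) :* (con 1 :+ n) :+ (con 1 :+ n)
             := con 2 :* (con 1 :+ n) :+ (n :* n :+ n)) refl n ⟩
      2 * suc n + (n * n + n)
        ≤⟨ +-mono-≤ (*-monoʳ-≤ 2 (s≤s (length≤out+in u us))) (many-hits us) ⟩
      2 * suc (outDeg u us + inDeg us u) + 2 * hits us us
        ≡⟨ solve 3 (λ o i h → con 2 :* (con 1 :+ (o :+ i)) :+ con 2 :* h
             := con 2 :* ((con 1 :+ o) :+ (i :+ h))) refl (outDeg u us) (inDeg us u) (hits us us) ⟩
      2 * ((1 + outDeg u us) + (inDeg us u + hits us us))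
        ≡⟨ cong₂ (λ a b → 2 * ((a + outDeg u us) + b)) (hit-self u) (hits-∷ us u us) ⟨
      2 * hits (u ∷ us) (u ∷ us) ∎
      where
      open ≤-Reasoning
      open +-*-Solver
      n = length us

    -- Averaging: if no entry of `ws` covers more than half of `us`, adding up the out-degrees gives
    -- the second alternative.
    find-big : ∀ us ws → (∃ λ w → w ∈ₗ ws × length us < 2 * outDeg w us)
                       ⊎ 2 * hits ws us ≤ length ws * length us
    find-big us [] = inj₂ z≤n
    find-big us (w ∷ ws) with length us <? 2 * outDeg w us | find-big us ws
    ... | yes big | _ = inj₁ (w , here refl , big)
    ... | no _ | inj₁ (w′ , w′∈ , big) = inj₁ (w′ , there w′∈ , big)
    ... | no small | inj₂ few = inj₂ (≤-trans (≤-reflexive (*-distribˡ-+ 2 (outDeg w us) (hits ws us)))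
                                              (+-mono-≤ (≮⇒≥ small) few))

    -- If no vertex covered more than half of the n entries, there would be at most n² / 2 covered
    -- pairs, against the lower bound (n² + n) / 2.
    halving-vertex : ∀ u us → let Q = u ∷ us in ∃ λ w → w ∈ₗ Q × 2 * length (unhit w Q) < length Q
    halving-vertex u us with find-big (u ∷ us) (u ∷ us)
    ... | inj₂ few = contradiction (≤-trans (many-hits (u ∷ us)) few)
                       (<⇒≱ (m<m+n (length (u ∷ us) * length (u ∷ us)) (s≤s z≤n)))
    ... | inj₁ (w , w∈ , big) = w , w∈ , (begin-strict
        2 * r    ≡⟨ cong (r +_) (+-identityʳ r) ⟩
        r + r    <⟨ +-monoˡ-< r r<o ⟩
        o + r    ≡⟨ out+unhit w Q ⟩
        length Q ∎)
      where
      open ≤-Reasoning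
      Q = u ∷ us
      r = length (unhit w Q)
      o = outDeg w Q
      r<o : r < o
      r<o = +-cancelˡ-< o _ _ (begin-strict
        o + r    ≡⟨ out+unhit w Q ⟩
        length Q <⟨ big ⟩
        2 * o    ≡⟨ cong (o +_) (+-identityʳ o) ⟩
        o + o    ∎)

    -- Greedy choice: a vertex covering more than half of `Q` is taken, and the recursion treats the
    -- uncovered remainder, whose length is below half the former bound. After `s` rounds nothing
    -- remains.
    dominating : ∀ s Q → length Q < 2 ^ s → ∃ λ I → length I ≤ s × (∀ {w} → w ∈ₗ I → w ∈ₗ Q)
                 × (∀ {u} → u ∈ₗ Q → ∃ λ w → w ∈ₗ I × cov w u ≡ true)
    dominating zero [] _ = [] , z≤n , (λ ()) , λ ()
    dominating zero (_ ∷ _) (s≤s ())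
    dominating (suc s) [] _ = [] , z≤n , (λ ()) , λ ()
    dominating (suc s) (x ∷ xs) Q<2^s
      with (w , w∈ , half) ← halving-vertex x xs
      with (I , I≤s , I⊆ , dom) ← dominating s (unhit w (x ∷ xs))
             (*-cancelˡ-< 2 _ _ (<-trans half Q<2^s))
      = w ∷ I , s≤s I≤s , sub , dom′
      where
      miss? = λ u → cov w u Bool.≟ false
      sub : ∀ {v} → v ∈ₗ w ∷ I → v ∈ₗ x ∷ xs
      sub (here refl) = w∈
      sub (there v∈) = proj₁ (∈ₗ.∈-filter⁻ miss? (I⊆ v∈))
      dom′ : ∀ {u} → u ∈ₗ x ∷ xs → ∃ λ v → v ∈ₗ w ∷ I × cov v u ≡ true
      dom′ {u} u∈ with cov w u in eq
      ... | true = w , here refl , eq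
      ... | false = let (v , v∈ , hit) = dom (∈ₗ.∈-filter⁺ miss? u∈ eq) in v , there v∈ , hit

private
  _∈ₗ?_ : ∀ {n} (i : Fin n) is → Dec (i ∈ₗ is)
  _∈ₗ?_ = DecMembership._∈?_ Fin._≟_

TwiceDominated : ∀ {ℓ} → Rel₂ ℓ → List (Fin ℓ) → Fin ℓ → Set
TwiceDominated t I i = ∃₂ λ j₁ j₂ → j₁ ≢ j₂ × (j₁ ∈ₗ I × t j₁ i ≡ true) × (j₂ ∈ₗ I × t j₂ i ≡ true)

module _ {ℓ} (t : Rel₂ ℓ) (t-total : ∀ i j → i ≢ j → t i j ≡ true ⊎ t j i ≡ true) where

  private
    cov : Rel₂ ℓ
    cov i j = does (i Fin.≟ j) ∨ t i j

    cov-total : ∀ i j → cov i j ≡ true ⊎ cov j i ≡ true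
    cov-total i j with i Fin.≟ j | j Fin.≟ i
    ... | yes _ | _ = inj₁ refl
    ... | no _ | yes _ = inj₂ refl
    ... | no _ | no j≢i = t-total i j (j≢i ∘ sym)

    cov⇒t : ∀ {i j} → i ≢ j → cov i j ≡ true → t i j ≡ true
    cov⇒t {i} {j} i≢j c with i Fin.≟ j
    ... | yes i≡j = contradiction i≡j i≢j
    ... | no _ = c

  -- The second dominating set is chosen in the subtournament that remains once the first is removed.
  twice-dominating : ∀ s → ℓ < 2 ^ s → ∃ λ I → length I ≤ s + s × (∀ i → i ∈ₗ I ⊎ TwiceDominated t I i)
  twice-dominating s ℓ<2^s
    with ∣all∣ ← subst (_< 2 ^ s) (sym (List.length-tabulate {n = ℓ} (λ i → i))) ℓ<2^s
    with (I₁ , I₁≤s , _ , dom₁) ← dominating cov cov-total s (allFin ℓ) ∣all∣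
    with rest? ← (λ i → ¬? (i ∈ₗ? I₁))
    with (I₂ , I₂≤s , I₂⊆ , dom₂) ← dominating cov cov-total s (filter rest? (allFin ℓ))
           (≤-<-trans (List.length-filter rest? (allFin ℓ)) ∣all∣)
    = I₁ ++ I₂ , ≤-trans (≤-reflexive (List.length-++ I₁)) (+-mono-≤ I₁≤s I₂≤s) , covered
    where
    covered : ∀ i → i ∈ₗ I₁ ++ I₂ ⊎ TwiceDominated t (I₁ ++ I₂) i
    covered i with i ∈ₗ? I₁ | i ∈ₗ? I₂
    ... | yes i∈ | _ = inj₁ (∈ₗ.∈-++⁺ˡ i∈)
    ... | no _ | yes i∈ = inj₁ (∈ₗ.∈-++⁺ʳ I₁ i∈)
    ... | no i∉₁ | no i∉₂
      with (j₁ , j₁∈ , c₁) ← dom₁ (∈ₗ.∈-allFin i)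
      with (j₂ , j₂∈ , c₂) ← dom₂ (∈ₗ.∈-filter⁺ rest? (∈ₗ.∈-allFin i) i∉₁)
      = inj₂ (j₁ , j₂
        , (λ { refl → proj₂ (∈ₗ.∈-filter⁻ rest? {xs = allFin ℓ} (I₂⊆ j₂∈)) j₁∈ })
        , (∈ₗ.∈-++⁺ˡ j₁∈ , cov⇒t (λ { refl → i∉₁ j₁∈ }) c₁)
        , (∈ₗ.∈-++⁺ʳ I₁ j₂∈ , cov⇒t (λ { refl → i∉₂ j₂∈ }) c₂))

-- The gadget inside a cell

pattern 𝕡 = zero
pattern 𝕢 = suc zero
pattern 𝕣 = suc (suc zero)
pattern 𝕓 = suc (suc (suc zero))
pattern 𝕔 = suc (suc (suc (suc zero)))

Kind : Set
Kind = Fin 5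

-- Each edge of the gadget in one direction only, so that this is also an orientation of it.
edge : Kind → Kind → Bool
edge 𝕡 𝕢 = true
edge 𝕡 𝕣 = true
edge 𝕢 𝕣 = true
edge 𝕡 𝕓 = true
edge 𝕢 𝕔 = true
edge _ _ = false

local : Kind → Kind → Bool
local k k′ = edge k k′ ∨ edge k′ k

layerOf : Kind → Fin 3
layerOf 𝕓 = 1F
layerOf 𝕔 = 2F
layerOf _ = 0F

layer : Kind → Kind → Bool
layer k k′ = does (layerOf k Fin.≟ layerOf k′)

edge-irrefl : ∀ k → edge k k ≡ false
edge-irrefl = from-yes (Fin.all? λ k → edge k k Bool.≟ false)

edge-asym : ∀ k k′ → ¬ (edge k k′ ≡ true × edge k′ k ≡ true)
edge-asym = from-yes (Fin.all? λ k → Fin.all? λ k′ →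
  ¬? ((edge k k′ Bool.≟ true) ×-dec (edge k′ k Bool.≟ true)))

edge⇒local : ∀ k k′ → edge k k′ ≡ true → local k k′ ≡ true
edge⇒local k k′ e rewrite e = refl

local⇒edge : ∀ k k′ → local k k′ ≡ true → edge k k′ ≡ true ⊎ edge k′ k ≡ true
local⇒edge = from-yes (Fin.all? λ k → Fin.all? λ k′ →
  (local k k′ Bool.≟ true) →-dec ((edge k k′ Bool.≟ true) ⊎-dec (edge k′ k Bool.≟ true)))

layer-sym : ∀ k k′ → layer k k′ ≡ layer k′ k
layer-sym = from-yes (Fin.all? λ k → Fin.all? λ k′ → layer k k′ Bool.≟ layer k′ k)

layer-refl : ∀ k → layer k k ≡ true
layer-refl = from-yes (Fin.all? λ k → layer k k Bool.≟ true)

layer-trans : ∀ m k k′ → layer k k′ ≡ true → layer m k ≡ layer m k′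
layer-trans = from-yes (Fin.all? λ m → Fin.all? λ k → Fin.all? λ k′ →
  (layer k k′ Bool.≟ true) →-dec (layer m k Bool.≟ layer m k′))

-- As `m` differs from both kinds, it separates the open and the closed neighbourhoods alike.
local-separator : ∀ k k′ → k ≢ k′ → layer k k′ ≡ true →
                  ∃ λ m → m ≢ k × m ≢ k′ × local m k ≢ local m k′
local-separator = from-yes (Fin.all? λ k → Fin.all? λ k′ → ¬? (k Fin.≟ k′) →-dec
  ((layer k k′ Bool.≟ true) →-dec Fin.any? λ m → ¬? (m Fin.≟ k) ×-dec (¬? (m Fin.≟ k′)
    ×-dec ¬? (local m k Bool.≟ local m k′))))

-- Once `m` is chosen in a cell, `u` and `v` are the only pair of distinct kinds left in a common
-- layer, hence the only pair to be separated inside the cell.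
Triangle : Kind → Kind → Kind → Set
Triangle m u v = ∀ k k′ → layer k k′ ≡ true → k ≢ k′ → k ≢ m → k′ ≢ m →
                 (k ≡ u × k′ ≡ v) ⊎ (k ≡ v × k′ ≡ u)

triangle? : ∀ m u v → Dec (Triangle m u v)
triangle? m u v = Fin.all? λ k → Fin.all? λ k′ → (layer k k′ Bool.≟ true) →-dec (¬? (k Fin.≟ k′) →-dec
  (¬? (k Fin.≟ m) →-dec (¬? (k′ Fin.≟ m) →-dec
    (((k Fin.≟ u) ×-dec (k′ Fin.≟ v)) ⊎-dec ((k Fin.≟ v) ×-dec (k′ Fin.≟ u))))))

-- Every tournament on three vertices has a vertex with one in-neighbour and one out-neighbour.
middle : (t : Kind → Kind → Bool) →
         (∀ k k′ → local k k′ ≡ true → t k k′ ≡ true ⊎ t k′ k ≡ true) →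
         (∀ k k′ → ¬ (t k k′ ≡ true × t k′ k ≡ true)) →
         ∃ λ m → ∀ k k′ → layer k k′ ≡ true → k ≢ k′ → k ≢ m → k′ ≢ m → t m k ≢ t m k′
middle t total asym = choose (t 𝕡 𝕢 Bool.≟ t 𝕡 𝕣) (t 𝕢 𝕡 Bool.≟ t 𝕢 𝕣)
  where
  flip-not : ∀ k k′ → local k k′ ≡ true → t k k′ ≡ not (t k′ k)
  flip-not k k′ e with t k k′ in eq | t k′ k in eq′ | total k k′ e
  ... | true  | false | _ = refl
  ... | false | true  | _ = refl
  ... | true  | true  | _ = contradiction (eq , eq′) (asym k k′)
  ... | false | false | inj₁ ()
  ... | false | false | inj₂ ()
  from : ∀ {m u v} → Triangle m u v → t m u ≢ t m v →
         ∃ λ m → ∀ k k′ → layer k k′ ≡ true → k ≢ k′ → k ≢ m → k′ ≢ m → t m k ≢ t m k′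
  from {m} tri sep = m , λ k k′ lay k≢k′ k≢m k′≢m eq → [ (λ { (refl , refl) → sep eq })
    , (λ { (refl , refl) → sep (sym eq) }) ]′ (tri k k′ lay k≢k′ k≢m k′≢m)
  choose : Dec (t 𝕡 𝕢 ≡ t 𝕡 𝕣) → Dec (t 𝕢 𝕡 ≡ t 𝕢 𝕣) → _
  choose (no sep) _ = from (from-yes (triangle? 𝕡 𝕢 𝕣)) sep
  choose (yes _) (no sep) = from (from-yes (triangle? 𝕢 𝕡 𝕣)) sep
  -- Here each of `𝕡` and `𝕢` is a source or a sink of the triangle. Were `𝕣` one as well, passing
  -- through the three arcs would flip the value an odd number of times.
  choose (yes eq) (yes eq′) = from (from-yes (triangle? 𝕣 𝕡 𝕢)) λ eq″ → Bool.not-¬ refl (begin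
    t 𝕡 𝕢       ≡⟨ eq ⟩
    t 𝕡 𝕣       ≡⟨ flip-not 𝕡 𝕣 refl ⟩
    not (t 𝕣 𝕡) ≡⟨ cong not eq″ ⟩
    not (t 𝕣 𝕢) ≡⟨ flip-not 𝕢 𝕣 refl ⟨
    t 𝕢 𝕣       ≡⟨ eq′ ⟨
    t 𝕢 𝕡       ≡⟨ flip-not 𝕢 𝕡 refl ⟩
    not (t 𝕡 𝕢) ∎)
    where open ≡-Reasoning

-- `M` is meant as the set of chosen kinds in one cell. A chosen triangle vertex is adjacent to the
-- other two, so it cannot separate them and a second member is needed. If no triangle vertex is
-- chosen, no single member separates `𝕣` from both `𝕡` and `𝕢`.
two-members : {M : Kind → Set} → Decidable M →
  (∀ k k′ → layer k k′ ≡ true → k ≢ k′ → ¬ M k → ¬ M k′ → ∃ λ m → M m × local m k ≢ local m k′) →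
  ∃₂ λ k k′ → k ≢ k′ × M k × M k′
two-members M? sep with M? 𝕡 | M? 𝕢 | M? 𝕣
... | yes p | yes q | _ = 𝕡 , 𝕢 , (λ ()) , p , q
... | yes p | no _ | yes r = 𝕡 , 𝕣 , (λ ()) , p , r
... | no _ | yes q | yes r = 𝕢 , 𝕣 , (λ ()) , q , r
... | yes p | no ¬q | no ¬r with (m , Mm , s) ← sep 𝕢 𝕣 refl (λ ()) ¬q ¬r
  = 𝕡 , m , (λ { refl → s refl }) , p , Mm
two-members M? sep | no ¬p | yes q | no ¬r with (m , Mm , s) ← sep 𝕡 𝕣 refl (λ ()) ¬p ¬r
  = 𝕢 , m , (λ { refl → s refl }) , q , Mm
two-members M? sep | no ¬p | no ¬q | yes r with (m , Mm , s) ← sep 𝕡 𝕢 refl (λ ()) ¬p ¬q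
  = 𝕣 , m , (λ { refl → s refl }) , r , Mm
two-members {M} M? sep | no ¬p | no ¬q | no ¬r
  with (m , Mm , s) ← sep 𝕡 𝕣 refl (λ ()) ¬p ¬r
  with (m′ , Mm′ , s′) ← sep 𝕢 𝕣 refl (λ ()) ¬q ¬r
  = m , m′ , (λ { refl → exclusive m (λ { refl → ¬r Mm }) (s , s′) }) , Mm , Mm′
  where
  exclusive : ∀ m → m ≢ 𝕣 → ¬ (local m 𝕡 ≢ local m 𝕣 × local m 𝕢 ≢ local m 𝕣)
  exclusive = from-yes (Fin.all? λ m → ¬? (m Fin.≟ 𝕣) →-dec
    ¬? (¬? (local m 𝕡 Bool.≟ local m 𝕣) ×-dec ¬? (local m 𝕢 Bool.≟ local m 𝕣)))

other-than : ∀ {ℓ} → 3 ≤ ℓ → (i : Fin ℓ) → ∃₂ λ j k → j ≢ k × j ≢ i × k ≢ i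
other-than (s≤s (s≤s (s≤s _))) 0F = 1F , 2F , (λ ()) , (λ ()) , λ ()
other-than (s≤s (s≤s (s≤s _))) 1F = 0F , 2F , (λ ()) , (λ ()) , λ ()
other-than (s≤s (s≤s (s≤s _))) (suc (suc _)) = 0F , 1F , (λ ()) , (λ ()) , λ ()

-- The first two arguments tell whether two cells agree in the first and in the second coordinate.
pick : Bool → Bool → Bool → Bool → Bool
pick true true inCell _ = inCell
pick true false _ inLine = inLine
pick false true _ inLine = inLine
pick false false _ _ = false

-- The graph

module Grid (ℓ : ℕ) where

  Cell : Set
  Cell = Fin ℓ × Fin ℓ

  Vertex : Set
  Vertex = Cell × Kind

  size : ℕ → ℕ
  size c = ℓ * ℓ * c

  -- The fibre size `c` is kept free: 5 gives the vertices of the graph, while 1 and 2 index choices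
  -- of one or two vertices per cell.
  enc : ∀ {c} → Cell × Fin c → Fin (size c)
  enc ((x , y) , k) = combine (combine x y) k

  dec : ∀ {c} → Fin (size c) → Cell × Fin c
  dec {c} i = let (z , k) = remQuot {ℓ * ℓ} c i in remQuot ℓ z , k

  dec-enc : ∀ {c} (a : Cell × Fin c) → dec (enc a) ≡ a
  dec-enc ((x , y) , k) = trans
    (cong (λ p → remQuot ℓ (proj₁ p) , proj₂ p) (Fin.remQuot-combine (combine x y) k))
    (cong (_, k) (Fin.remQuot-combine x y))

  enc-dec : ∀ {c} (i : Fin (size c)) → enc (dec {c} i) ≡ i
  enc-dec {c} i = trans (cong (λ z → combine z (proj₂ (remQuot {ℓ * ℓ} c i)))
                              (Fin.combine-remQuot {ℓ} ℓ (proj₁ (remQuot {ℓ * ℓ} c i))))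
                        (Fin.combine-remQuot {ℓ * ℓ} c i)

  enc-injective : ∀ {c} {a b : Cell × Fin c} → enc a ≡ enc b → a ≡ b
  enc-injective {a = a} {b} eq = trans (sym (dec-enc a)) (trans (cong dec eq) (dec-enc b))

  enc-surjective : ∀ {c} (i : Fin (size c)) → ∃ λ a → enc {c} a ≡ i
  enc-surjective i = dec i , enc-dec i

  -- Opaque, so that unification recovers the two relations and the vertices from spread inCell inLine a b.
  opaque

    spread : (Kind → Kind → Bool) → (Vertex → Vertex → Bool) → Vertex → Vertex → Bool
    spread inCell inLine a@((x , y) , k) b@((x′ , y′) , k′) =
      pick (does (x Fin.≟ x′)) (does (y Fin.≟ y′)) (inCell k k′) (inLine a b)

  module _ {inCell : Kind → Kind → Bool} {inLine : Vertex → Vertex → Bool} where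

    private R = spread inCell inLine

    opaque
      unfolding spread

      spread-cell : ∀ z {k k′} → R (z , k) (z , k′) ≡ inCell k k′
      spread-cell (x , y) rewrite dec-true (x Fin.≟ x) refl | dec-true (y Fin.≟ y) refl = refl

      spread-row : ∀ {x x′ y k k′} → x ≢ x′ →
                   R ((x , y) , k) ((x′ , y) , k′) ≡ inLine ((x , y) , k) ((x′ , y) , k′)
      spread-row {x} {x′} {y} x≢x′
        rewrite dec-false (x Fin.≟ x′) x≢x′ | dec-true (y Fin.≟ y) refl = refl

      spread-col : ∀ {x y y′ k k′} → y ≢ y′ →
                   R ((x , y) , k) ((x , y′) , k′) ≡ inLine ((x , y) , k) ((x , y′) , k′)
      spread-col {x} {y} {y′} y≢y′
        rewrite dec-true (x Fin.≟ x) refl | dec-false (y Fin.≟ y′) y≢y′ = refl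

      spread-far : ∀ {x x′ y y′ k k′} → x ≢ x′ → y ≢ y′ → R ((x , y) , k) ((x′ , y′) , k′) ≡ false
      spread-far {x} {x′} {y} {y′} x≢x′ y≢y′
        rewrite dec-false (x Fin.≟ x′) x≢x′ | dec-false (y Fin.≟ y′) y≢y′ = refl

      -- From outside the cell only `inLine` can contribute, and it does not distinguish the two
      -- vertices.
      separator-in-cell : ∀ {z k k′} → (∀ w → inLine w (z , k) ≡ inLine w (z , k′)) →
        ∀ w → R w (z , k) ≢ R w (z , k′) → proj₁ w ≡ z × inCell (proj₂ w) k ≢ inCell (proj₂ w) k′
      separator-in-cell {x , y} alike w@((x′ , y′) , m) sep with x′ Fin.≟ x | y′ Fin.≟ y
      ... | yes refl | yes refl = refl , sep
      ... | yes _    | no _     = contradiction (alike w) sep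
      ... | no _     | yes _    = contradiction (alike w) sep
      ... | no _     | no _     = contradiction refl sep

  opaque
    unfolding spread

    spread-sym : ∀ {inCell inLine} → (∀ k k′ → inCell k k′ ≡ inCell k′ k) →
                 (∀ a b → inLine a b ≡ inLine b a) →
                 ∀ a b → spread inCell inLine a b ≡ spread inCell inLine b a
    spread-sym cell-sym line-sym a@((x , y) , k) b@((x′ , y′) , k′)
      with x Fin.≟ x′ | y Fin.≟ y′
    ... | yes refl | yes refl
      rewrite dec-true (x Fin.≟ x) refl | dec-true (y Fin.≟ y) refl
      = cell-sym k k′
    ... | yes refl | no y≢y′
      rewrite dec-true (x Fin.≟ x) refl | dec-false (y′ Fin.≟ y) (y≢y′ ∘ sym)
      = line-sym a b
    ... | no x≢x′ | yes refl
      rewrite dec-false (x′ Fin.≟ x) (x≢x′ ∘ sym) | dec-true (y Fin.≟ y) refl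
      = line-sym a b
    ... | no x≢x′ | no y≢y′
      rewrite dec-false (x′ Fin.≟ x) (x≢x′ ∘ sym) | dec-false (y′ Fin.≟ y) (y≢y′ ∘ sym)
      = refl

    spread-never : ∀ {inCell inLine a b} → inCell (proj₂ a) (proj₂ b) ≡ false → inLine a b ≡ false →
                   spread inCell inLine a b ≡ false
    spread-never {a = (x , y) , _} {(x′ , y′) , _} cell line with does (x Fin.≟ x′) | does (y Fin.≟ y′)
    ... | true  | true  = cell
    ... | true  | false = line
    ... | false | true  = line
    ... | false | false = refl

    spread-other : ∀ {inCell inLine a b} → proj₁ a ≢ proj₁ b → inLine a b ≡ false →
                   spread inCell inLine a b ≡ false
    spread-other {a = (x , y) , _} {(x′ , y′) , _} z≢z′ line with x Fin.≟ x′ | y Fin.≟ y′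
    ... | yes refl | yes refl = contradiction refl z≢z′
    ... | yes _ | no _  = line
    ... | no _  | yes _ = line
    ... | no _  | no _  = refl

    spread-mono : ∀ {inCell inLine inCell′ inLine′} →
                  (∀ k k′ → inCell k k′ ≡ true → inCell′ k k′ ≡ true) →
                  (∀ a b → inLine a b ≡ true → inLine′ a b ≡ true) →
                  ∀ a b → spread inCell inLine a b ≡ true → spread inCell′ inLine′ a b ≡ true
    spread-mono cell line a@((x , y) , k) b@((x′ , y′) , k′) with does (x Fin.≟ x′) | does (y Fin.≟ y′)
    ... | true  | true  = cell k k′
    ... | true  | false = line a b
    ... | false | true  = line a b
    ... | false | false = λ r → r

  spread-total : ∀ {inCell inLine inCell′ inLine′} →
                 (∀ k k′ → inCell k k′ ≡ true → inCell′ k k′ ≡ true ⊎ inCell′ k′ k ≡ true) →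
                 (∀ a b → proj₁ a ≢ proj₁ b → inLine a b ≡ true → inLine′ a b ≡ true ⊎ inLine′ b a ≡ true) →
                 ∀ a b → spread inCell inLine a b ≡ true →
                 spread inCell′ inLine′ a b ≡ true ⊎ spread inCell′ inLine′ b a ≡ true
  spread-total cell line a@((x , y) , k) b@((x′ , y′) , k′) r
    with x Fin.≟ x′ | y Fin.≟ y′
  ... | yes refl | yes refl = Sum.map (trans (spread-cell _)) (trans (spread-cell _))
          (cell k k′ (trans (sym (spread-cell _)) r))
  ... | yes refl | no y≢y′ = Sum.map (trans (spread-col y≢y′)) (trans (spread-col (y≢y′ ∘ sym)))
          (line a b (λ { refl → y≢y′ refl }) (trans (sym (spread-col y≢y′)) r))
  ... | no x≢x′ | yes refl = Sum.map (trans (spread-row x≢x′)) (trans (spread-row (x≢x′ ∘ sym)))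
          (line a b (λ { refl → x≢x′ refl }) (trans (sym (spread-row x≢x′)) r))
  ... | no x≢x′ | no y≢y′ = contradiction (trans (sym r) (spread-far x≢x′ y≢y′)) λ ()

  spread-asym : ∀ {inCell inLine} → (∀ k k′ → ¬ (inCell k k′ ≡ true × inCell k′ k ≡ true)) →
                (∀ a b → ¬ (inLine a b ≡ true × inLine b a ≡ true)) →
                ∀ a b → ¬ (spread inCell inLine a b ≡ true × spread inCell inLine b a ≡ true)
  spread-asym cell line a@((x , y) , k) b@((x′ , y′) , k′) (r , r′) with x Fin.≟ x′ | y Fin.≟ y′
  ... | yes refl | yes refl = cell k k′ (trans (sym (spread-cell _)) r , trans (sym (spread-cell _)) r′)
  ... | yes refl | no y≢y′ = line a b
          (trans (sym (spread-col y≢y′)) r , trans (sym (spread-col (y≢y′ ∘ sym))) r′)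
  ... | no x≢x′ | yes refl = line a b
          (trans (sym (spread-row x≢x′)) r , trans (sym (spread-row (x≢x′ ∘ sym))) r′)
  ... | no x≢x′ | no y≢y′ = contradiction (trans (sym r) (spread-far x≢x′ y≢y′)) λ ()

  adj : Vertex → Vertex → Bool
  adj = spread local (λ (_ , k) (_ , k′) → layer k k′)

  graph : Graph (size 5)
  graph = record
    { Adj = λ u v → adj (dec u) (dec v)
    ; sym = λ u v → spread-sym (λ k k′ → Bool.∨-comm (edge k k′) (edge k′ k))
        (λ (_ , k) (_ , k′) → layer-sym k k′) (dec u) (dec v)
    ; irrefl = λ u → trans (spread-cell (proj₁ (dec {5} u)))
        (cong₂ _∨_ (edge-irrefl (proj₂ (dec {5} u))) (edge-irrefl (proj₂ (dec {5} u))))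
    }

  Adj-enc : ∀ a b → Adj graph (enc a) (enc b) ≡ adj a b
  Adj-enc a b = cong₂ adj (dec-enc a) (dec-enc b)

  -- Separation along the lines through a vertex; twin-freeness

  NonNbr : Vertex → Vertex → Set
  NonNbr w b = w ≢ b × adj w b ≡ false

  -- A cell outside row `y` shares a line with at most one of `(x₁ , y)` and `(x₂ , y)`, and a cell
  -- of row `y` other than `(x , y)` shares none with `(x , y₁)`. In the cell `(x , y)` itself, `b`
  -- lies in another layer than `k`.
  missed-neighbour : ∀ {x y k x₁ x₂ y₁} b → x₁ ≢ x₂ → x₁ ≢ x → y₁ ≢ y →
    (proj₁ b ≡ (x , y) → layer k (proj₂ b) ≡ false) →
    NonNbr ((x₁ , y) , k) b ⊎ NonNbr ((x₂ , y) , k) b ⊎ NonNbr ((x , y₁) , k) b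
  missed-neighbour {x} {y} {k} {x₁} {x₂} {y₁} ((x′ , y′) , k′) x₁≢x₂ x₁≢x y₁≢y apart
    with x′ Fin.≟ x | y′ Fin.≟ y
  ... | yes refl | yes refl = inj₁ ((λ { refl → x₁≢x refl }) , trans (spread-row x₁≢x) (apart refl))
  ... | yes refl | no y′≢y = inj₁ ((λ { refl → x₁≢x refl }) , spread-far x₁≢x (y′≢y ∘ sym))
  ... | no x′≢x | yes refl = inj₂ (inj₂ ((λ { refl → x′≢x refl }) , spread-far (x′≢x ∘ sym) y₁≢y))
  ... | no _ | no y′≢y = case x₁ Fin.≟ x′ of λ where
    (no x₁≢x′) → inj₁ ((λ { refl → x₁≢x′ refl }) , spread-far x₁≢x′ (y′≢y ∘ sym))
    (yes refl) → inj₂ (inj₁ ((λ { refl → x₁≢x₂ refl }) , spread-far (x₁≢x₂ ∘ sym) (y′≢y ∘ sym)))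

  -- The split tells where to look for a separator: inside the common cell, or on the row and column
  -- of `a`.
  alike⊎apart : ∀ (a b : Vertex) → (proj₁ b ≡ proj₁ a × layer (proj₂ a) (proj₂ b) ≡ true)
                                 ⊎ (proj₁ b ≡ proj₁ a → layer (proj₂ a) (proj₂ b) ≡ false)
  alike⊎apart ((x , y) , k) ((x′ , y′) , k′) with x′ Fin.≟ x | y′ Fin.≟ y | layer k k′
  ... | yes refl | yes refl | true = inj₁ (refl , refl)
  ... | yes _ | yes _ | false = inj₂ λ _ → refl
  ... | yes _ | no y′≢y | _ = inj₂ λ { refl → contradiction refl y′≢y }
  ... | no x′≢x | _ | _ = inj₂ λ { refl → contradiction refl x′≢x }

  module _ (3≤ℓ : 3 ≤ ℓ) where

    -- A `w` distinct from both vertices rules out the two kinds of twins at once, since open and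
    -- closed adjacency agree at `w`.
    separator : ∀ a b → a ≢ b → ∃ λ w → w ≢ a × w ≢ b × adj w a ≢ adj w b
    separator a@((x , y) , k) b@(_ , k′) a≢b with alike⊎apart a b
    ... | inj₁ (refl , lay)
      with (m , m≢k , m≢k′ , sep) ← local-separator k k′ (λ { refl → a≢b refl }) lay
      = ((x , y) , m) , (λ { refl → m≢k refl }) , (λ { refl → m≢k′ refl })
      , λ eq → sep (trans (sym (spread-cell (x , y))) (trans eq (spread-cell (x , y))))
    ... | inj₂ apart
      with (x₁ , x₂ , x₁≢x₂ , x₁≢x , x₂≢x) ← other-than 3≤ℓ x
      with (y₁ , _ , _ , y₁≢y , _) ← other-than 3≤ℓ y
      with missed-neighbour {k = k} b x₁≢x₂ x₁≢x y₁≢y apart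
    ... | inj₁ (≢b , far) = _ , (λ { refl → x₁≢x refl }) , ≢b ,
            λ eq → contradiction (trans (sym (trans (spread-row x₁≢x) (layer-refl k))) (trans eq far)) λ ()
    ... | inj₂ (inj₁ (≢b , far)) = _ , (λ { refl → x₂≢x refl }) , ≢b ,
            λ eq → contradiction (trans (sym (trans (spread-row x₂≢x) (layer-refl k))) (trans eq far)) λ ()
    ... | inj₂ (inj₂ (≢b , far)) = _ , (λ { refl → y₁≢y refl }) , ≢b ,
            λ eq → contradiction (trans (sym (trans (spread-col y₁≢y) (layer-refl k))) (trans eq far)) λ ()

    twinFree : TwinFree graph
    twinFree u v u≢v
      with (a , refl) ← enc-surjective u | (b , refl) ← enc-surjective v
      with (w , w≢a , w≢b , sep) ← separator a b (λ { refl → u≢v refl })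
      = (λ same → sep (trans (sym (Adj-enc w a)) (trans (same (enc w)) (Adj-enc w b))))
      , (λ same → sep (trans (sym (CAdj-enc w≢a)) (trans (same (enc w)) (CAdj-enc w≢b))))
      where
      CAdj-enc : ∀ {w a} → w ≢ a → CAdj graph (enc w) (enc a) ≡ adj w a
      CAdj-enc {w} {a} w≢a rewrite dec-false (enc w Fin.≟ enc a) (w≢a ∘ enc-injective) = Adj-enc w a

  -- Sets given by lists of vertices, and counting by cells

  isLD-fromList : ∀ {R : Rel₂ (size 5)} (L : List Vertex) →
    (∀ a → a ∉ₗ L → ∃ λ w → w ∈ₗ L × R (enc w) (enc a) ≡ true) →
    (∀ a b → a ∉ₗ L → b ∉ₗ L → a ≢ b → ∃ λ w → w ∈ₗ L × R (enc w) (enc a) ≢ R (enc w) (enc b)) →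
    IsLD R (fromList (map enc L))
  isLD-fromList {R} L dom loc = dom′ , loc′
    where
    member : ∀ {a} → a ∈ₗ L → enc a ∈ fromList (map enc L)
    member = ∈-fromList ∘ ∈ₗ.∈-map⁺ enc
    dom′ : ∀ u → u ∉ _ → _
    dom′ u u∉
      with (a , refl) ← enc-surjective u
      with (w , w∈ , r) ← dom a (u∉ ∘ member)
      = enc w , member w∈ , r
    loc′ : ∀ u v → u ∉ _ → v ∉ _ → u ≢ v → _
    loc′ u v u∉ v∉ u≢v same
      with (a , refl) ← enc-surjective u | (b , refl) ← enc-surjective v
      with (w , w∈ , sep) ← loc a b (u∉ ∘ member) (v∉ ∘ member) (u≢v ∘ cong enc)
      = sep (same (enc w) (member w∈))

  length-bound : ∀ {R : Rel₂ (size 5)} {j} (L : List Vertex) → IsγLD R j →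
                 IsLD R (fromList (map enc L)) → j ≤ length L
  length-bound L (_ , min) ld = ≤-trans (min _ ld)
    (≤-trans (∣fromList∣≤length (map enc L)) (≤-reflexive (List.length-map enc L)))

  transversal : ∀ {c} → (Cell → Fin c → Kind) → List Vertex
  transversal {c} g =
    map (λ i → proj₁ (dec {c} i) , g (proj₁ (dec {c} i)) (proj₂ (dec {c} i))) (allFin (size c))

  ∈-transversal : ∀ {c} (g : Cell → Fin c → Kind) z e → (z , g z e) ∈ₗ transversal g
  ∈-transversal g z e = subst (_∈ₗ transversal g) (cong (λ (z , e) → z , g z e) (dec-enc (z , e)))
    (∈ₗ.∈-map⁺ _ (∈ₗ.∈-allFin (enc (z , e))))

  length-transversal : ∀ {c} (g : Cell → Fin c → Kind) → length (transversal g) ≡ size c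
  length-transversal {c} g = trans (List.length-map _ (allFin (size c)))
    (List.length-tabulate {n = size c} (λ i → i))

  -- Vertices of different cells are distinct anyway, so injectivity of `g` is required only within
  -- each cell. Both lower bounds are obtained this way.
  transversal⊆⇒≤ : ∀ {c} (T : Subset (size 5)) (g : Cell → Fin c → Kind) →
                   (∀ z {e e′} → g z e ≡ g z e′ → e ≡ e′) →
                   (∀ z e → enc (z , g z e) ∈ T) → size c ≤ ∣ T ∣
  transversal⊆⇒≤ {c} T g g-inj g∈ = injection⇒≤∣∣ T
    (λ i → enc (proj₁ (dec {c} i) , g (proj₁ (dec {c} i)) (proj₂ (dec {c} i)))) inj (λ i → g∈ _ _)
    where
    unique : ∀ {a b : Cell × Fin c} →
             (proj₁ a , g (proj₁ a) (proj₂ a)) ≡ (proj₁ b , g (proj₁ b) (proj₂ b)) → a ≡ b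
    unique {z , e} {z′ , e′} eq with refl ← cong proj₁ eq = cong (z ,_) (g-inj z (cong proj₂ eq))
    inj : Injective _≡_ _≡_ _
    inj {i} {j} eq = trans (sym (enc-dec {c} i)) (trans (cong enc (unique (enc-injective eq))) (enc-dec {c} j))

  lines : (Fin ℓ → Kind → List Vertex) → List Vertex
  lines f = concatMap (λ i → f (proj₁ (remQuot {ℓ} 5 i)) (proj₂ (remQuot {ℓ} 5 i))) (allFin (ℓ * 5))

  ∈-lines : ∀ f i k {a} → a ∈ₗ f i k → a ∈ₗ lines f
  ∈-lines f i k {a} a∈ = ∈ₗ.∈-concatMap⁺ _ (lose (∈ₗ.∈-allFin (combine i k))
    (subst (λ (i , k) → a ∈ₗ f i k) (sym (Fin.remQuot-combine i k)) a∈))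

  length-lines : ∀ f {c} → (∀ i k → length (f i k) ≤ c) → length (lines f) ≤ ℓ * 5 * c
  length-lines f {c} bnd = ≤-trans (length-concatMap-≤ _ (λ i → bnd _ _) (allFin (ℓ * 5)))
    (≤-reflexive (cong (_* c) (List.length-tabulate {n = ℓ * 5} (λ i → i))))

  -- Location-domination in the graph itself

  Separates : List Vertex → Vertex → Vertex → Set
  Separates L a b = ∃ λ w → w ∈ₗ L × adj w a ≡ true × adj w b ≡ false

  separates⇒≢ : ∀ {L a b} → Separates L a b ⊎ Separates L b a →
                ∃ λ w → w ∈ₗ L × Adj graph (enc w) (enc a) ≢ Adj graph (enc w) (enc b)
  separates⇒≢ {L} {a} {b} (inj₁ (w , w∈ , near , far)) = w , w∈ , λ eq →
    contradiction (trans (sym (trans (Adj-enc w a) near)) (trans eq (trans (Adj-enc w b) far))) λ ()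
  separates⇒≢ {L} {a} {b} (inj₂ (w , w∈ , near , far)) = w , w∈ , λ eq →
    contradiction (trans (sym (trans (Adj-enc w b) near)) (trans (sym eq) (trans (Adj-enc w a) far))) λ ()

  pq : Fin 2 → Kind
  pq 0F = 𝕡
  pq 1F = 𝕢

  pqCells : List Vertex
  pqCells = transversal (λ _ → pq)

  p∈ : ∀ z → (z , 𝕡) ∈ₗ pqCells
  p∈ z = ∈-transversal (λ _ → pq) z 0F

  q∈ : ∀ z → (z , 𝕢) ∈ₗ pqCells
  q∈ z = ∈-transversal (λ _ → pq) z 1F

  module _ (3≤ℓ : 3 ≤ ℓ) where

    -- For cells on no common line the `𝕡` of `z` itself serves. For cells on a common line, a
    -- further cell on the perpendicular line through `z` shares no line with `z′`.
    𝕣-separated : ∀ z z′ → z ≢ z′ → Separates pqCells (z , 𝕣) (z′ , 𝕣)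
    𝕣-separated z@(x , y) z′@(x′ , y′) z≢z′ with x Fin.≟ x′ | y Fin.≟ y′
    ... | yes refl | yes refl = contradiction refl z≢z′
    ... | no x≢x′ | no y≢y′ = (z , 𝕡) , p∈ z , spread-cell z , spread-far x≢x′ y≢y′
    ... | no x≢x′ | yes refl with (y₁ , _ , _ , y₁≢y , _) ← other-than 3≤ℓ y
      = ((x , y₁) , 𝕡) , p∈ _ , spread-col y₁≢y , spread-far x≢x′ y₁≢y
    𝕣-separated z@(x , y) z′@(x′ , y′) z≢z′ | yes refl | no y≢y′
      with (x₁ , _ , _ , x₁≢x , _) ← other-than 3≤ℓ x
      = ((x₁ , y) , 𝕡) , p∈ _ , spread-row x₁≢x , spread-far x₁≢x y≢y′

    -- Among the chosen vertices, a `𝕓` sees only the `𝕡` of its cell and a `𝕔` only the `𝕢` of its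
    -- cell, whereas an `𝕣` sees both in its own cell.
    pq-separated : ∀ a b → a ∉ₗ pqCells → b ∉ₗ pqCells → a ≢ b →
                   Separates pqCells a b ⊎ Separates pqCells b a
    pq-separated (z , 𝕡) _ a∉ _ _ = contradiction (p∈ z) a∉
    pq-separated (z , 𝕢) _ a∉ _ _ = contradiction (q∈ z) a∉
    pq-separated _ (z , 𝕡) _ b∉ _ = contradiction (p∈ z) b∉
    pq-separated _ (z , 𝕢) _ b∉ _ = contradiction (q∈ z) b∉
    pq-separated (z , 𝕣) (z′ , 𝕣) _ _ a≢b = inj₁ (𝕣-separated z z′ (a≢b ∘ cong (_, 𝕣)))
    pq-separated (z , 𝕣) (_ , 𝕓) _ _ _ = inj₁ ((z , 𝕢) , q∈ z , spread-cell z , spread-never refl refl)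
    pq-separated (z , 𝕣) (_ , 𝕔) _ _ _ = inj₁ ((z , 𝕡) , p∈ z , spread-cell z , spread-never refl refl)
    pq-separated (_ , 𝕓) (z , 𝕣) _ _ _ = inj₂ ((z , 𝕢) , q∈ z , spread-cell z , spread-never refl refl)
    pq-separated (_ , 𝕔) (z , 𝕣) _ _ _ = inj₂ ((z , 𝕡) , p∈ z , spread-cell z , spread-never refl refl)
    pq-separated (z , 𝕓) (_ , 𝕔) _ _ _ = inj₁ ((z , 𝕡) , p∈ z , spread-cell z , spread-never refl refl)
    pq-separated (_ , 𝕔) (z , 𝕓) _ _ _ = inj₂ ((z , 𝕡) , p∈ z , spread-cell z , spread-never refl refl)
    pq-separated (z , 𝕓) (_ , 𝕓) _ _ a≢b =
      inj₁ ((z , 𝕡) , p∈ z , spread-cell z , spread-other (a≢b ∘ cong (_, 𝕓)) refl)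
    pq-separated (z , 𝕔) (_ , 𝕔) _ _ a≢b =
      inj₁ ((z , 𝕢) , q∈ z , spread-cell z , spread-other (a≢b ∘ cong (_, 𝕔)) refl)

    pq-isLD : IsLD (Adj graph) (fromList (map enc pqCells))
    pq-isLD = isLD-fromList pqCells dom λ a b a∉ b∉ a≢b → separates⇒≢ (pq-separated a b a∉ b∉ a≢b)
      where
      dom : ∀ a → a ∉ₗ pqCells → ∃ λ w → w ∈ₗ pqCells × Adj graph (enc w) (enc a) ≡ true
      dom (z , 𝕡) a∉ = contradiction (p∈ z) a∉
      dom (z , 𝕢) a∉ = contradiction (q∈ z) a∉
      dom (z , 𝕣) _ = (z , 𝕡) , p∈ z , trans (Adj-enc _ _) (spread-cell z)
      dom (z , 𝕓) _ = (z , 𝕡) , p∈ z , trans (Adj-enc _ _) (spread-cell z)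
      dom (z , 𝕔) _ = (z , 𝕢) , q∈ z , trans (Adj-enc _ _) (spread-cell z)

    γ-upper : ∀ {j} → γLD≡ graph j → j ≤ size 2
    γ-upper γ = ≤-trans (length-bound pqCells γ pq-isLD) (≤-reflexive (length-transversal (λ _ → pq)))

  -- Kinds of one layer in one cell have the same neighbours outside the cell, so their separators
  -- lie inside it and `two-members` applies.
  isLD⇒two-per-cell : ∀ {T} → IsLD (Adj graph) T → ∀ z →
                      ∃₂ λ k k′ → k ≢ k′ × enc (z , k) ∈ T × enc (z , k′) ∈ T
  isLD⇒two-per-cell {T} ld z = two-members (λ k → enc (z , k) ∈? T) sep
    where
    sep : ∀ k k′ → layer k k′ ≡ true → k ≢ k′ → enc (z , k) ∉ T → enc (z , k′) ∉ T →
          ∃ λ m → enc (z , m) ∈ T × local m k ≢ local m k′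
    sep k k′ lay k≢k′ k∉ k′∉
      with (w , w∈ , Rw) ← isLD⇒separator ld k∉ k′∉ (k≢k′ ∘ cong proj₂ ∘ enc-injective)
      with ((_ , m) , refl) ← enc-surjective w
      with (refl , loc) ← separator-in-cell (λ (_ , m) → layer-trans m k k′ lay) (_ , m)
             (λ eq → Rw (trans (Adj-enc _ _) (trans eq (sym (Adj-enc _ _)))))
      = m , w∈ , loc

  γ-lower : ∀ {j} → γLD≡ graph j → size 2 ≤ j
  γ-lower ((T , ld , refl) , _) = transversal⊆⇒≤ T (λ z → two z) two-injective two∈
    where
    two : Cell → Fin 2 → Kind
    two z 0F = proj₁ (isLD⇒two-per-cell ld z)
    two z 1F = proj₁ (proj₂ (isLD⇒two-per-cell ld z))
    two-injective : ∀ z {e e′} → two z e ≡ two z e′ → e ≡ e′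
    two-injective z {0F} {0F} _ = refl
    two-injective z {0F} {1F} eq = contradiction eq (proj₁ (proj₂ (proj₂ (isLD⇒two-per-cell ld z))))
    two-injective z {1F} {0F} eq = contradiction (sym eq) (proj₁ (proj₂ (proj₂ (isLD⇒two-per-cell ld z))))
    two-injective z {1F} {1F} _ = refl
    two∈ : ∀ z e → enc (z , two z e) ∈ T
    two∈ z 0F = proj₁ (proj₂ (proj₂ (proj₂ (isLD⇒two-per-cell ld z))))
    two∈ z 1F = proj₂ (proj₂ (proj₂ (proj₂ (isLD⇒two-per-cell ld z))))

  -- Location-domination in orientations

  before : Cell → Cell → Bool
  before (x , y) (x′ , y′) = does (combine x y Fin.<? combine x′ y′)

  before-asym : ∀ z z′ → ¬ (before z z′ ≡ true × before z′ z ≡ true)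
  before-asym (x , y) (x′ , y′) (r , r′) =
    Fin.<-asym (does⇒ (combine x y Fin.<? combine x′ y′) r) (does⇒ (combine x′ y′ Fin.<? combine x y) r′)

  before-total : ∀ z z′ → z ≢ z′ → before z z′ ≡ true ⊎ before z′ z ≡ true
  before-total (x , y) (x′ , y′) z≢z′ with Fin.<-cmp (combine x y) (combine x′ y′)
  ... | tri< lt _ _ = inj₁ (dec-true (_ Fin.<? _) lt)
  ... | tri> _ _ gt = inj₂ (dec-true (_ Fin.<? _) gt)
  ... | tri≈ _ eq _ with (refl , refl) ← Fin.combine-injective x y x′ y′ eq = contradiction refl z≢z′

  arcLine : Vertex → Vertex → Bool
  arcLine (z , k) (z′ , k′) = layer k k′ ∧ before z z′

  arc₀ : Vertex → Vertex → Bool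
  arc₀ = spread edge arcLine

  orientation₀ : Orientation graph
  orientation₀ = record
    { Arc = λ u v → arc₀ (dec u) (dec v)
    ; arc⇒edge = λ u v → spread-mono edge⇒local
        (λ (z , k) (z′ , k′) → Bool.∧-conicalˡ (layer k k′) (before z z′)) (dec u) (dec v)
    ; edge⇒arc = λ u v → spread-total local⇒edge line-total (dec u) (dec v)
    ; antisym = λ u v → spread-asym edge-asym (λ (z , k) (z′ , k′) (r , r′) → before-asym z z′
        (Bool.∧-conicalʳ (layer k k′) _ r , Bool.∧-conicalʳ (layer k′ k) _ r′)) (dec u) (dec v)
    }
    where
    line-total : ∀ a b → proj₁ a ≢ proj₁ b → layer (proj₂ a) (proj₂ b) ≡ true →
                 arcLine a b ≡ true ⊎ arcLine b a ≡ true
    line-total (z , k) (z′ , k′) z≢z′ lay rewrite layer-sym k′ k | lay = before-total z z′ z≢z′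

  -- 𝕢 and 𝕣 have the same in-neighbours in orientation₀, apart from 𝕢 itself.
  𝕢⊎𝕣 : ∀ {T} → IsLD (Arc orientation₀) T → ∀ z → enc (z , 𝕢) ∈ T ⊎ enc (z , 𝕣) ∈ T
  𝕢⊎𝕣 {T} ld z with enc (z , 𝕢) ∈? T | enc (z , 𝕣) ∈? T
  ... | yes q∈T | _ = inj₁ q∈T
  ... | no _ | yes r∈T = inj₂ r∈T
  ... | no q∉T | no r∉T
    with (w , w∈ , Rw) ← isLD⇒separator ld q∉T r∉T (λ eq → contradiction (cong proj₂ (enc-injective {5} eq)) λ ())
    with ((_ , m) , refl) ← enc-surjective w
    with (refl , loc) ← separator-in-cell
           (λ ((z′ , m) : Vertex) → cong (_∧ before z′ z) (layer-trans m 𝕢 𝕣 refl)) (_ , m)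
           (λ eq → Rw (trans (cong₂ arc₀ (dec-enc _) (dec-enc _))
             (trans eq (sym (cong₂ arc₀ (dec-enc (_ , m)) (dec-enc (z , 𝕣)))))))
    = contradiction (subst (λ k → enc (z , k) ∈ T) (only-𝕢 m loc) w∈) q∉T
    where
    only-𝕢 : ∀ m → edge m 𝕢 ≢ edge m 𝕣 → m ≡ 𝕢
    only-𝕢 = from-yes (Fin.all? λ m → ¬? (edge m 𝕢 Bool.≟ edge m 𝕣) →-dec (m Fin.≟ 𝕢))

  Γ-lower : ∀ {j} → ΓLD≡ graph j → size 1 ≤ j
  Γ-lower (_ , max) with (i , γ@((T , ld , refl) , _)) ← ∃γLD (Arc orientation₀)
    = ≤-trans (transversal⊆⇒≤ T (λ z _ → chosen z) (λ { _ {0F} {0F} _ → refl }) (λ z _ → chosen∈ z))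
              (max orientation₀ i γ)
    where
    chosen : Cell → Kind
    chosen z = [ (λ _ → 𝕢) , (λ _ → 𝕣) ]′ (𝕢⊎𝕣 ld z)
    chosen∈ : ∀ z → enc (z , chosen z) ∈ T
    chosen∈ z with 𝕢⊎𝕣 ld z
    ... | inj₁ q∈T = q∈T
    ... | inj₂ r∈T = r∈T

  -- A small locating-dominating set for an arbitrary orientation

  module _ (D : Orientation graph) (s : ℕ) (ℓ<2^s : ℓ < 2 ^ s) where

    arc : Vertex → Vertex → Bool
    arc a b = Arc D (enc a) (enc b)

    arc-total : ∀ a b → adj a b ≡ true → arc a b ≡ true ⊎ arc b a ≡ true
    arc-total a b e = edge⇒arc D (enc a) (enc b) (trans (Adj-enc a b) e)

    nonadj⇒nonarc : ∀ a b → adj a b ≡ false → arc a b ≡ false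
    nonadj⇒nonarc a b e with arc a b in eq
    ... | false = refl
    ... | true = contradiction (trans (sym (arc⇒edge D _ _ eq)) (trans (Adj-enc a b) e)) λ ()

    inRow inCol : Fin ℓ → Kind → Fin ℓ → Vertex
    inRow y k x = (x , y) , k
    inCol x k y = (x , y) , k

    rowArc colArc : Fin ℓ → Kind → Rel₂ ℓ
    rowArc y k x x′ = arc (inRow y k x) (inRow y k x′)
    colArc x k y y′ = arc (inCol x k y) (inCol x k y′)

    opaque

      mid : ∀ z → ∃ λ m → ∀ k k′ → layer k k′ ≡ true → k ≢ k′ → k ≢ m → k′ ≢ m →
            arc (z , m) (z , k) ≢ arc (z , m) (z , k′)
      mid z = middle (λ k k′ → arc (z , k) (z , k′))
        (λ k k′ e → arc-total _ _ (trans (spread-cell z) e)) (λ k k′ → antisym D _ _)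

      rowSet : ∀ y k → ∃ λ I → length I ≤ s + s × (∀ x → x ∈ₗ I ⊎ TwiceDominated (rowArc y k) I x)
      rowSet y k = twice-dominating (rowArc y k)
        (λ x x′ x≢x′ → arc-total _ _ (trans (spread-row x≢x′) (layer-refl k))) s ℓ<2^s

      colSet : ∀ x k → ∃ λ I → length I ≤ s + s × (∀ y → y ∈ₗ I ⊎ TwiceDominated (colArc x k) I y)
      colSet x k = twice-dominating (colArc x k)
        (λ y y′ y≢y′ → arc-total _ _ (trans (spread-col y≢y′) (layer-refl k))) s ℓ<2^s

      rowLine colLine : Fin ℓ → Kind → List Vertex
      rowLine y k = map (inRow y k) (proj₁ (rowSet y k))
      colLine x k = map (inCol x k) (proj₁ (colSet x k))

      mids rows cols L : List Vertex
      mids = transversal {1} (λ z _ → proj₁ (mid z))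
      rows = lines rowLine
      cols = lines colLine
      L = mids ++ rows ++ cols

    opaque
      unfolding L

      length-rowLine : ∀ y k → length (rowLine y k) ≤ s + s
      length-rowLine y k =
        ≤-trans (≤-reflexive (List.length-map (inRow y k) (proj₁ (rowSet y k)))) (proj₁ (proj₂ (rowSet y k)))

      length-colLine : ∀ x k → length (colLine x k) ≤ s + s
      length-colLine x k =
        ≤-trans (≤-reflexive (List.length-map (inCol x k) (proj₁ (colSet x k)))) (proj₁ (proj₂ (colSet x k)))

      length-L : length L ≤ size 1 + (ℓ * 5 * (s + s) + ℓ * 5 * (s + s))
      length-L = begin
        length L                                  ≡⟨ List.length-++ mids ⟩
        length mids + length (rows ++ cols)       ≡⟨ cong (length mids +_) (List.length-++ rows) ⟩
        length mids + (length rows + length cols)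
          ≤⟨ +-mono-≤ (≤-reflexive (length-transversal {1} (λ z _ → proj₁ (mid z))))
               (+-mono-≤ (length-lines rowLine length-rowLine) (length-lines colLine length-colLine)) ⟩
        size 1 + (ℓ * 5 * (s + s) + ℓ * 5 * (s + s)) ∎
        where open ≤-Reasoning

      mid∈ : ∀ z → (z , proj₁ (mid z)) ∈ₗ L
      mid∈ z = ∈ₗ.∈-++⁺ˡ (∈-transversal {1} (λ z _ → proj₁ (mid z)) z 0F)

      row∈ : ∀ {y k x} → x ∈ₗ proj₁ (rowSet y k) → inRow y k x ∈ₗ L
      row∈ {y} {k} x∈ = ∈ₗ.∈-++⁺ʳ mids (∈ₗ.∈-++⁺ˡ (∈-lines rowLine y k (∈ₗ.∈-map⁺ (inRow y k) x∈)))

      col∈ : ∀ {x k y} → y ∈ₗ proj₁ (colSet x k) → inCol x k y ∈ₗ L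
      col∈ {x} {k} y∈ = ∈ₗ.∈-++⁺ʳ mids (∈ₗ.∈-++⁺ʳ rows (∈-lines colLine x k (∈ₗ.∈-map⁺ (inCol x k) y∈)))

    row-dominators : ∀ {x y k} → ((x , y) , k) ∉ₗ L → TwiceDominated (rowArc y k) (proj₁ (rowSet y k)) x
    row-dominators {x} {y} {k} a∉ with proj₂ (proj₂ (rowSet y k)) x
    ... | inj₁ x∈ = contradiction (row∈ x∈) a∉
    ... | inj₂ twice = twice

    col-dominators : ∀ {x y k} → ((x , y) , k) ∉ₗ L → TwiceDominated (colArc x k) (proj₁ (colSet x k)) y
    col-dominators {x} {y} {k} a∉ with proj₂ (proj₂ (colSet x k)) y
    ... | inj₁ y∈ = contradiction (col∈ y∈) a∉
    ... | inj₂ twice = twice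

    -- A chosen in-neighbour of `a` that is not adjacent to `b` separates the two. Two row
    -- dominators and one column dominator of `a` provide such a vertex, unless `a` and `b` share
    -- cell and layer; then the middle vertex of their cell does.
    L-separates : ∀ a b → a ∉ₗ L → b ∉ₗ L → a ≢ b → ∃ λ w → w ∈ₗ L × arc w a ≢ arc w b
    L-separates a@(z@(x , y) , k) b@(_ , k′) a∉ b∉ a≢b with alike⊎apart a b
    ... | inj₁ (refl , lay) = (z , proj₁ (mid z)) , mid∈ z , proj₂ (mid z) k k′ lay
            (λ { refl → a≢b refl }) (λ { refl → a∉ (mid∈ z) }) (λ { refl → b∉ (mid∈ z) })
    ... | inj₂ apart
      with (x₁ , x₂ , x₁≢x₂ , (x₁∈ , arc₁) , (x₂∈ , arc₂)) ← row-dominators a∉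
      with (y₁ , _ , _ , (y₁∈ , arc₃) , _) ← col-dominators a∉
      -- A dominator in the position of `a` would be `a` itself, which is not in `L`; this gives the
      -- two required inequalities.
      with missed-neighbour {k = k} b x₁≢x₂ (λ { refl → a∉ (row∈ x₁∈) }) (λ { refl → a∉ (col∈ y₁∈) }) apart
    ... | inj₁ (_ , far) = _ , row∈ x₁∈ , λ eq →
            contradiction (trans (sym arc₁) (trans eq (nonadj⇒nonarc _ b far))) λ ()
    ... | inj₂ (inj₁ (_ , far)) = _ , row∈ x₂∈ , λ eq →
            contradiction (trans (sym arc₂) (trans eq (nonadj⇒nonarc _ b far))) λ ()
    ... | inj₂ (inj₂ (_ , far)) = _ , col∈ y₁∈ , λ eq →
            contradiction (trans (sym arc₃) (trans eq (nonadj⇒nonarc _ b far))) λ ()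

    L-isLD : IsLD (Arc D) (fromList (map enc L))
    L-isLD = isLD-fromList L dom L-separates
      where
      dom : ∀ a → a ∉ₗ L → ∃ λ w → w ∈ₗ L × arc w a ≡ true
      dom a a∉ with (_ , _ , _ , (x₁∈ , arc₁) , _) ← row-dominators a∉ = _ , row∈ x₁∈ , arc₁

  Γ-upper : ∀ {j} s → ℓ < 2 ^ s → ΓLD≡ graph j → j ≤ size 1 + (ℓ * 5 * (s + s) + ℓ * 5 * (s + s))
  Γ-upper s ℓ<2^s ((D , γ) , _) = ≤-trans (length-bound (L D s ℓ<2^s) γ (L-isLD D s ℓ<2^s)) (length-L D s ℓ<2^s)

  -- With γ = 2 ℓ² and ℓ² ≤ Γ ≤ ℓ² + 20 ℓ s, the difference 2 Γ - γ lies between 0 and 40 ℓ s. The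
  -- last hypothesis makes `suc m` times this smaller than 4 ℓ² = 2 γ.
  ratio-near-half : 3 ≤ ℓ → ∀ {γ Γ} → γLD≡ graph γ → ΓLD≡ graph Γ →
    ∀ m s → ℓ < 2 ^ s → 10 * suc m * s < ℓ → suc m * ∣ 2 * Γ - γ ∣ < 2 * γ
  ratio-near-half 3≤ℓ {γ} {Γ} γ-is Γ-is m s ℓ<2^s small
    with refl ← ≤-antisym (γ-upper 3≤ℓ γ-is) (γ-lower γ-is) = begin-strict
      suc m * ∣ 2 * Γ - size 2 ∣     ≡⟨ cong (suc m *_) (m≤n⇒∣n-m∣≡n∸m 2N≤) ⟩
      suc m * (2 * Γ ∸ size 2)       ≤⟨ *-monoʳ-≤ (suc m) (m≤n+o⇒m∸n≤o (2 * Γ) (size 2) ≤2N+e) ⟩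
      suc m * (40 * (ℓ * s))         ≡⟨ solve 3 (λ m l s → m :* (con 40 :* (l :* s)) := con 4 :* (con 10 :* m :* s :* l))
                                          refl (suc m) ℓ s ⟩
      4 * (10 * suc m * s * ℓ)       <⟨ *-monoʳ-< 4 (*-monoˡ-< ℓ {{>-nonZero (≤-trans (s≤s z≤n) 3≤ℓ)}} small) ⟩
      4 * (ℓ * ℓ)                    ≡⟨ solve 1 (λ n → con 4 :* n := con 2 :* (n :* con 2)) refl (ℓ * ℓ) ⟩
      2 * size 2                     ∎
    where
    open ≤-Reasoning
    open +-*-Solver
    2N≤ : size 2 ≤ 2 * Γ
    2N≤ = ≤-trans (≤-reflexive (solve 1 (λ n → n :* con 2 := con 2 :* (n :* con 1)) refl (ℓ * ℓ)))
                  (*-monoʳ-≤ 2 (Γ-lower Γ-is))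
    ≤2N+e : 2 * Γ ≤ size 2 + 40 * (ℓ * s)
    ≤2N+e = ≤-trans (*-monoʳ-≤ 2 (Γ-upper s ℓ<2^s Γ-is))
      (≤-reflexive (solve 2 (λ l s → con 2 :* (l :* l :* con 1 :+ (l :* con 5 :* (s :+ s) :+ l :* con 5 :* (s :+ s)))
        := l :* l :* con 2 :+ con 40 :* (l :* s)) refl ℓ s))

-- Growth estimate and the family of graphs

n<2^n : ∀ n → n < 2 ^ n
n<2^n zero = s≤s z≤n
n<2^n (suc n) = ≤-trans (+-mono-≤ (≤-trans (s≤s z≤n) (n<2^n n)) (n<2^n n))
  (≤-reflexive (cong (2 ^ n +_) (sym (+-identityʳ (2 ^ n)))))

linear<exponential : ∀ c → ∃ λ K → ∀ s → K ≤ s → c * suc s < 2 ^ s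
-- With j = 3 + c, the power 2 ^ j exceeds c and is at least 1 + 2 j = 7 + 2 c, so the inequality
-- holds at s = 2 j. From there on, each step doubles the right side and at most doubles the left.
linear<exponential c = j + j , λ s K≤s → subst (λ s → c * suc s < 2 ^ s) (m∸n+n≡m K≤s) (from-K (s ∸ (j + j)))
  where
  open ≤-Reasoning
  open +-*-Solver
  j = 3 + c
  7+2c≤2^3+c : ∀ c → 7 + 2 * c ≤ 2 ^ (3 + c)
  7+2c≤2^3+c zero = m≤m+n 7 1
  7+2c≤2^3+c (suc c) = begin
    7 + 2 * suc c             ≤⟨ m≤m+n _ (5 + 2 * c) ⟩
    7 + 2 * suc c + (5 + 2 * c) ≡⟨ solve 1 (λ c → con 7 :+ con 2 :* (con 1 :+ c) :+ (con 5 :+ con 2 :* c)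
                                      := con 2 :* (con 7 :+ con 2 :* c)) refl c ⟩
    2 * (7 + 2 * c)           ≤⟨ *-monoʳ-≤ 2 (7+2c≤2^3+c c) ⟩
    2 ^ (3 + suc c)           ∎
  c<2^j : c < 2 ^ j
  c<2^j = <-trans (m<n+m c (s≤s z≤n)) (n<2^n j)
  from-K : ∀ d → c * suc (d + (j + j)) < 2 ^ (d + (j + j))
  from-K zero = begin-strict
    c * suc (j + j)    ≡⟨ cong (c *_) (solve 1
                              (λ c → con 1 :+ ((con 3 :+ c) :+ (con 3 :+ c)) := con 7 :+ con 2 :* c) refl c) ⟩
    c * (7 + 2 * c)    ≤⟨ *-monoʳ-≤ c (7+2c≤2^3+c c) ⟩
    c * 2 ^ j          <⟨ *-monoˡ-< (2 ^ j) {{m^n≢0 2 j}} c<2^j ⟩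
    2 ^ j * 2 ^ j      ≡⟨ ^-distribˡ-+-* 2 j j ⟨
    2 ^ (j + j)        ∎
  from-K (suc d) = begin-strict
    c * suc (suc t)         ≤⟨ *-monoʳ-≤ c (s≤s (m≤n+m (suc t) t)) ⟩
    c * suc (t + suc t)     ≡⟨ solve 2 (λ c t → c :* (con 1 :+ (t :+ (con 1 :+ t)))
                                 := con 2 :* (c :* (con 1 :+ t))) refl c t ⟩
    2 * (c * suc t)         <⟨ *-monoʳ-< 2 (from-K d) ⟩
    2 * 2 ^ t               ∎
    where t = d + (j + j)

theorem40 : Σ (ℕ → Σ ℕ Graph) λ F →
    (∀ k → proj₁ (F k) < proj₁ (F (suc k)))
    × (∀ k → TwinFree (proj₂ (F k)))
    × Σ (ℕ → ℕ) λ γ → Σ (ℕ → ℕ) λ Γ →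
    (∀ k → γLD≡ (proj₂ (F k)) (γ k))
    × (∀ k → ΓLD≡ (proj₂ (F k)) (Γ k))
    × TendsToHalf Γ γ
theorem40 =
  (λ k → Grid.size (side k) 5 , Grid.graph (side k)) ,
  (λ k → *-monoˡ-< 5 (*-mono-< (side-mono k) (side-mono k))) ,
  (λ k → Grid.twinFree (side k) (3≤side k)) ,
  (λ k → proj₁ (γ k)) , (λ k → proj₁ (Γ k)) , (λ k → proj₂ (γ k)) , (λ k → proj₂ (Γ k)) ,
  λ m → let (K , small) = linear<exponential (10 * suc m) in
    -- The exponent is 3 + k because `dominating` needs the side 2 ^ (2 + k) strictly below a power
    -- of two; this is why the growth estimate has `suc s` on its left.
    K , λ k K≤k → Grid.ratio-near-half (side k) (3≤side k) (proj₂ (γ k)) (proj₂ (Γ k)) m (3 + k)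
      (^-monoʳ-< 2 (s≤s (s≤s z≤n)) (n<1+n (2 + k))) (small (2 + k) (≤-trans K≤k (m≤n+m k 2)))
  where
  -- A power of two makes the logarithm of the side explicit; the offset 2 lets the sides start at
  -- 4, so that each line has at least three cells.
  side : ℕ → ℕ
  side k = 2 ^ (2 + k)
  side-mono : ∀ k → side k < side (suc k)
  side-mono k = ^-monoʳ-< 2 (s≤s (s≤s z≤n)) (n<1+n (2 + k))
  3≤side : ∀ k → 3 ≤ side k
  3≤side k = ≤-trans (m≤m+n 3 1) (^-monoʳ-≤ 2 (m≤m+n 2 k))
  γ : ∀ k → ∃ (γLD≡ (Grid.graph (side k)))
  γ k = ∃γLD (Adj (Grid.graph (side k)))
  Γ : ∀ k → ∃ (ΓLD≡ (Grid.graph (side k)))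
  Γ k = ∃ΓLD (Grid.graph (side k)) (Grid.orientation₀ (side k))
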